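{- Let $K$ and $S$ be Kleene algebras that are Morita-equivalent as Kleene algebras. Then there are a positive integer $n$ and a full multiplicative idempotent $e$ in the semiring $M$ of $n\times n$ matrices over $K$ such that $S\cong eMe$ as semirings.
   Context: A semiring $\langle S,+,\cdot,0,1\rangle$ is unital: $\langle S,+,0\rangle$ is a commutative monoid, $\langle S,\cdot,1\rangle$ is a monoid, $s0=0s=0$ for all $s$, and multiplication distributes over addition on both sides. A left module over a semiring $S$ is a commutative monoid $\langle M,+,0\rangle$ with a map $S\times M\to M$ satisfying $s(m+n)=sm+sn$, $(s+t)m=sm+tm$, $s(tm)=(st)m$, $1m=m$, $0m=0$; right modules are defined symmetrically. An $(S,T)$-bimodule is a left $S$-module and right $T$-module on the same commutative monoid with $s(mt)=(sm)t$. Homomorphisms are maps preserving addition and the scalar action(s); isomorphisms are invertible homomorphisms. A Kleene algebra is an additively idempotent semiring $K$ ($x+x=x$), ordered by $x\le y\iff x+y=y$, with a unary operation $*$ such that for all $x,y,z$: $1+xx^*=1+x^*x=x^*$; if $x+yz\le z$ then $y^*x\le z$; if $x+zy\le z$ then $xy^*\le z$. A left Kleene module over $K$ is a left module $M$ over the semiring reduct of $K$ such that $am\le m\Rightarrow a^*m\le m$ for all $a\in K$, $m\in M$ (where $x\le y\iff x+y=y$); a right Kleene module is defined symmetrically ($ma\le m\Rightarrow ma^*\le m$). A Kleene $(K,L)$-bimodule is a semiring $(K,L)$-bimodule that is both a left Kleene module over $K$ and a right Kleene module over $L$. Tensor product: for an $(A,B)$-bimodule $X$ and a $(B,C)$-bimodule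 $Y$, $X\otimes_B Y$ is the quotient of the commutative monoid of finite formal sums of pairs $(x,y)\in X\times Y$ by the least congruence under which the class $x\otimes y$ of $(x,y)$ is additive in each variable (with $0\otimes y=x\otimes 0=0$) and $B$-balanced, $xb\otimes y=x\otimes by$; it is an $(A,C)$-bimodule via $a(x\otimes y)=(ax)\otimes y$ and $(x\otimes y)c=x\otimes(yc)$. Kleene algebras $K$ and $S$ are Morita-equivalent as Kleene algebras if there are a Kleene $(K,S)$-bimodule $X$ and a Kleene $(S,K)$-bimodule $Y$ with $X\otimes_S Y\cong {}_KK_K$ and $Y\otimes_K X\cong {}_SS_S$ as bimodules, where ${}_KK_K$ is $K$ as a bimodule over itself by multiplication. An element $e$ of a semiring $R$ is multiplicatively idempotent if $e^2=e$, and full if $ReR=R$, where $ReR$ is the set of finite sums of elements $res$ with $r,s\in R$. For an idempotent $e\in R$, $eRe=\{ere: r\in R\}$ is a semiring with the operations of $R$ and multiplicative identity $e$. -}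

module Defs where

open import Algebra.Bundles using (IdempotentSemiring; Semiring)
import Algebra.Definitions as AlgebraDefinitions
open import Algebra.Module.Bundles
  using (Bisemimodule; LeftSemimodule; RightSemimodule)
import Algebra.Module.Construct.TensorUnit as TensorUnit
open import Algebra.Module.Morphism.Structures using (IsBisemimoduleIsomorphism)
open import Algebra.Morphism.Structures using (IsSemiringIsomorphism)
import Algebra.Properties.CommutativeSemigroup as CommutativeSemigroupProperties
import Algebra.Properties.Semiring.Sum as SemiringSum
open import Data.Bool.Base using (if_then_else_)
open import Data.Fin.Base using (Fin; zero; suc)
open import Data.Fin.Properties using (_≟_)
open import Data.List.Base using (List; []; _∷_; _++_; map)
open import Data.List.Properties using (map-++; ++-assoc; ++-identityʳ)
open import Data.Nat.Base using (ℕ)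
open import Data.Product.Base using (Σ; ∃; _×_; _,_; proj₁; proj₂; map₁; map₂)
open import Data.Vec.Functional using (Vector)
open import Function.Base using (_on_)
open import Level using (Level; _⊔_) renaming (suc to lsuc)
open import Relation.Binary.Core using (Rel)
open import Relation.Binary.PropositionalEquality.Core as ≡ using (_≡_)
import Relation.Binary.Reasoning.Setoid as SetoidReasoning
open import Relation.Nullary.Decidable.Core using (does)

------------------------------------------------------------------------
-- Kleene algebras and Kleene modules

-- The library's own KleeneAlgebra is not used: its star-induction laws read
-- b + a x ≈ x → (a ⋆) b ≈ x, which makes every fixed point of x ↦ b + a x
-- equal to (a ⋆) b instead of bounding it from below.

record KleeneAlgebra (c ℓ : Level) : Set (lsuc (c ⊔ ℓ)) where
  infix 9 _⋆
  infix 4 _≤_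

  field
    idempotentSemiring : IdempotentSemiring c ℓ

  open IdempotentSemiring idempotentSemiring public

  _≤_ : Rel Carrier ℓ
  x ≤ y = x + y ≈ y

  field
    _⋆           : Carrier → Carrier
    ⋆-cong       : ∀ {x y} → x ≈ y → x ⋆ ≈ y ⋆
    ⋆-unfoldʳ    : ∀ x → 1# + x * x ⋆ ≈ x ⋆
    ⋆-unfoldˡ    : ∀ x → 1# + x ⋆ * x ≈ x ⋆
    ⋆-inductionˡ : ∀ x y z → x + y * z ≤ z → y ⋆ * x ≤ z
    ⋆-inductionʳ : ∀ x y z → x + z * y ≤ z → x * y ⋆ ≤ z

module _ {c ℓ m ℓm : Level} (K : KleeneAlgebra c ℓ) where
  open KleeneAlgebra K using (Carrier; semiring; _⋆)

  IsLeftKleeneModule : LeftSemimodule semiring m ℓm → Set (c ⊔ m ⊔ ℓm)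
  IsLeftKleeneModule M = ∀ a x → a *ₗ x ≤ᴹ x → (a ⋆) *ₗ x ≤ᴹ x
    where
    open LeftSemimodule M
    infix 4 _≤ᴹ_
    _≤ᴹ_ : Rel Carrierᴹ ℓm
    x ≤ᴹ y = x +ᴹ y ≈ᴹ y

  IsRightKleeneModule : RightSemimodule semiring m ℓm → Set (c ⊔ m ⊔ ℓm)
  IsRightKleeneModule M = ∀ a x → x *ᵣ a ≤ᴹ x → x *ᵣ (a ⋆) ≤ᴹ x
    where
    open RightSemimodule M
    infix 4 _≤ᴹ_
    _≤ᴹ_ : Rel Carrierᴹ ℓm
    x ≤ᴹ y = x +ᴹ y ≈ᴹ y

record KleeneBimodule {c ℓ c′ ℓ′ : Level}
                      (K : KleeneAlgebra c ℓ) (L : KleeneAlgebra c′ ℓ′)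
                      (m ℓm : Level) : Set (c ⊔ ℓ ⊔ c′ ⊔ ℓ′ ⊔ lsuc (m ⊔ ℓm)) where
  field
    bisemimodule : Bisemimodule (KleeneAlgebra.semiring K)
                                (KleeneAlgebra.semiring L) m ℓm

  open Bisemimodule bisemimodule public

  field
    isLeftKleeneModule  : IsLeftKleeneModule K leftSemimodule
    isRightKleeneModule : IsRightKleeneModule L rightSemimodule

------------------------------------------------------------------------
-- Isomorphisms

module _ {r ℓr s ℓs : Level} where

  infix 4 _≅ˢ_

  _≅ˢ_ : Semiring r ℓr → Semiring s ℓs → Set (r ⊔ ℓr ⊔ s ⊔ ℓs)
  R ≅ˢ S = ∃ (IsSemiringIsomorphism (Semiring.rawSemiring R) (Semiring.rawSemiring S))

module _ {r ℓr s ℓs m ℓm n ℓn : Level}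
         {R : Semiring r ℓr} {S : Semiring s ℓs} where

  infix 4 _≅ᵇ_

  _≅ᵇ_ : Bisemimodule R S m ℓm → Bisemimodule R S n ℓn →
         Set (r ⊔ s ⊔ m ⊔ ℓm ⊔ n ⊔ ℓn)
  M ≅ᵇ N = ∃ (IsBisemimoduleIsomorphism (Bisemimodule.rawBisemimodule M)
                                        (Bisemimodule.rawBisemimodule N))

------------------------------------------------------------------------
-- Tensor products of bimodules

module Tensor {a ℓa b ℓb c ℓc x ℓx y ℓy : Level}
              {A : Semiring a ℓa} {B : Semiring b ℓb} {C : Semiring c ℓc}
              (X : Bisemimodule A B x ℓx) (Y : Bisemimodule B C y ℓy) where

  private
    module A = Semiring A
    module B = Semiring B
    module C = Semiring C
    module X = Bisemimodule X
    module Y = Bisemimodule Y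

  Pair : Set (x ⊔ y)
  Pair = X.Carrierᴹ × Y.Carrierᴹ

  -- The list (x₁ , y₁) ∷ … ∷ (xₙ , yₙ) ∷ [] stands for the formal sum of its
  -- entries, so [] is zero and _++_ is addition.

  FormalSum : Set (x ⊔ y)
  FormalSum = List Pair

  infix 8 _⊗_

  _⊗_ : X.Carrierᴹ → Y.Carrierᴹ → FormalSum
  x ⊗ y = (x , y) ∷ []

  infix 4 _∼_

  -- ++-comm makes formal sums commutative; ⊗-cong is needed because X and Y
  -- are themselves setoids.

  data _∼_ : Rel FormalSum (b ⊔ x ⊔ ℓx ⊔ y ⊔ ℓy) where
    ∼-refl  : ∀ {u} → u ∼ u
    ∼-sym   : ∀ {u v} → u ∼ v → v ∼ u
    ∼-trans : ∀ {u v w} → u ∼ v → v ∼ w → u ∼ w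
    ++-cong : ∀ {u u′ v v′} → u ∼ u′ → v ∼ v′ → u ++ v ∼ u′ ++ v′
    ++-comm : ∀ u v → u ++ v ∼ v ++ u
    ⊗-cong  : ∀ {x x′ y y′} → x X.≈ᴹ x′ → y Y.≈ᴹ y′ → x ⊗ y ∼ x′ ⊗ y′
    ⊗-addˡ  : ∀ x x′ y → (x X.+ᴹ x′) ⊗ y ∼ x ⊗ y ++ x′ ⊗ y
    ⊗-addʳ  : ∀ x y y′ → x ⊗ (y Y.+ᴹ y′) ∼ x ⊗ y ++ x ⊗ y′
    ⊗-zeroˡ : ∀ y → X.0ᴹ ⊗ y ∼ []
    ⊗-zeroʳ : ∀ x → x ⊗ Y.0ᴹ ∼ []
    ⊗-bal   : ∀ x b y → (x X.*ᵣ b) ⊗ y ∼ x ⊗ (b Y.*ₗ y)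

  _·ₗ_ : A.Carrier → FormalSum → FormalSum
  a ·ₗ u = map (map₁ (a X.*ₗ_)) u

  _·ᵣ_ : FormalSum → C.Carrier → FormalSum
  u ·ᵣ c = map (map₂ (Y._*ᵣ c)) u

  private
    ∼-reflexive : ∀ {u v} → u ≡ v → u ∼ v
    ∼-reflexive ≡.refl = ∼-refl

    ++-resp : ∀ (f : Pair → Pair) {u u′ v v′} → map f u ∼ map f u′ → map f v ∼ map f v′ →
              map f (u ++ v) ∼ map f (u′ ++ v′)
    ++-resp f {u} {u′} {v} {v′} p q =
      ∼-trans (∼-reflexive (map-++ f u v))
        (∼-trans (++-cong p q) (∼-sym (∼-reflexive (map-++ f u′ v′))))

    comm-resp : ∀ (f : Pair → Pair) u v → map f (u ++ v) ∼ map f (v ++ u)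
    comm-resp f u v =
      ∼-trans (∼-reflexive (map-++ f u v))
        (∼-trans (++-comm (map f u) (map f v)) (∼-sym (∼-reflexive (map-++ f v u))))

    ·ₗ-congʳ : ∀ a {u v} → u ∼ v → (a ·ₗ u) ∼ (a ·ₗ v)
    ·ₗ-congʳ a ∼-refl         = ∼-refl
    ·ₗ-congʳ a (∼-sym p)      = ∼-sym (·ₗ-congʳ a p)
    ·ₗ-congʳ a (∼-trans p q)  = ∼-trans (·ₗ-congʳ a p) (·ₗ-congʳ a q)
    ·ₗ-congʳ a (++-cong {u} {u′} p q) =
      ++-resp (map₁ (a X.*ₗ_)) {u} {u′} (·ₗ-congʳ a p) (·ₗ-congʳ a q)
    ·ₗ-congʳ a (++-comm u v)  = comm-resp (map₁ (a X.*ₗ_)) u v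
    ·ₗ-congʳ a (⊗-cong p q)   = ⊗-cong (X.*ₗ-cong A.refl p) q
    ·ₗ-congʳ a (⊗-addˡ x x′ y) =
      ∼-trans (⊗-cong (X.*ₗ-distribˡ a x x′) Y.≈ᴹ-refl) (⊗-addˡ _ _ y)
    ·ₗ-congʳ a (⊗-addʳ x y y′) = ⊗-addʳ _ y y′
    ·ₗ-congʳ a (⊗-zeroˡ y)    = ∼-trans (⊗-cong (X.*ₗ-zeroʳ a) Y.≈ᴹ-refl) (⊗-zeroˡ y)
    ·ₗ-congʳ a (⊗-zeroʳ x)    = ⊗-zeroʳ _
    ·ₗ-congʳ a (⊗-bal x b y)  =
      ∼-trans (⊗-cong (X.≈ᴹ-sym (X.*ₗ-*ᵣ-assoc a x b)) Y.≈ᴹ-refl) (⊗-bal _ b y)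

    ·ᵣ-congˡ : ∀ c {u v} → u ∼ v → (u ·ᵣ c) ∼ (v ·ᵣ c)
    ·ᵣ-congˡ c ∼-refl         = ∼-refl
    ·ᵣ-congˡ c (∼-sym p)      = ∼-sym (·ᵣ-congˡ c p)
    ·ᵣ-congˡ c (∼-trans p q)  = ∼-trans (·ᵣ-congˡ c p) (·ᵣ-congˡ c q)
    ·ᵣ-congˡ c (++-cong {u} {u′} p q) =
      ++-resp (map₂ (Y._*ᵣ c)) {u} {u′} (·ᵣ-congˡ c p) (·ᵣ-congˡ c q)
    ·ᵣ-congˡ c (++-comm u v)  = comm-resp (map₂ (Y._*ᵣ c)) u v
    ·ᵣ-congˡ c (⊗-cong p q)   = ⊗-cong p (Y.*ᵣ-cong q C.refl)
    ·ᵣ-congˡ c (⊗-addˡ x x′ y) = ⊗-addˡ x x′ _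
    ·ᵣ-congˡ c (⊗-addʳ x y y′) =
      ∼-trans (⊗-cong X.≈ᴹ-refl (Y.*ᵣ-distribʳ c y y′)) (⊗-addʳ x _ _)
    ·ᵣ-congˡ c (⊗-zeroˡ y)    = ⊗-zeroˡ _
    ·ᵣ-congˡ c (⊗-zeroʳ x)    = ∼-trans (⊗-cong X.≈ᴹ-refl (Y.*ᵣ-zeroˡ c)) (⊗-zeroʳ x)
    ·ᵣ-congˡ c (⊗-bal x b y)  =
      ∼-trans (⊗-bal x b _) (⊗-cong X.≈ᴹ-refl (Y.≈ᴹ-sym (Y.*ₗ-*ᵣ-assoc b y c)))

    map-∼ : ∀ {f g : Pair → Pair} →
            (∀ x y → (f (x , y) ∷ []) ∼ (g (x , y) ∷ [])) →
            ∀ u → map f u ∼ map g u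
    map-∼ p []            = ∼-refl
    map-∼ p ((x , y) ∷ u) = ++-cong (p x y) (map-∼ p u)

    map-∼-id : ∀ {f : Pair → Pair} →
               (∀ x y → (f (x , y) ∷ []) ∼ x ⊗ y) → ∀ u → map f u ∼ u
    map-∼-id p []            = ∼-refl
    map-∼-id p ((x , y) ∷ u) = ++-cong (p x y) (map-∼-id p u)

    map-∼-∘ : ∀ {f g h : Pair → Pair} →
              (∀ x y → (f (x , y) ∷ []) ∼ (g (h (x , y)) ∷ [])) →
              ∀ u → map f u ∼ map g (map h u)
    map-∼-∘ p []            = ∼-refl
    map-∼-∘ p ((x , y) ∷ u) = ++-cong (p x y) (map-∼-∘ p u)

    map-∼-zero : ∀ {f : Pair → Pair} →
                 (∀ x y → (f (x , y) ∷ []) ∼ []) → ∀ u → map f u ∼ []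
    map-∼-zero p []            = ∼-refl
    map-∼-zero p ((x , y) ∷ u) = ++-cong (p x y) (map-∼-zero p u)

    interchange : ∀ s t u v → (s ++ t) ++ (u ++ v) ∼ (s ++ u) ++ (t ++ v)
    interchange s t u v =
      ∼-trans (∼-reflexive (++-assoc s t (u ++ v)))
      (∼-trans (++-cong (∼-refl {s})
        (∼-trans (∼-reflexive (≡.sym (++-assoc t u v)))
        (∼-trans (++-cong (++-comm t u) (∼-refl {v}))
                 (∼-reflexive (++-assoc u t v)))))
      (∼-reflexive (≡.sym (++-assoc s u (t ++ v)))))

    map-∼-+ : ∀ {f g h : Pair → Pair} →
              (∀ x y → (f (x , y) ∷ []) ∼ (g (x , y) ∷ []) ++ (h (x , y) ∷ [])) →
              ∀ u → map f u ∼ map g u ++ map h u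
    map-∼-+ p []            = ∼-refl
    map-∼-+ {f} {g} {h} p ((x , y) ∷ u) =
      ∼-trans (++-cong (p x y) (map-∼-+ p u))
              (interchange (g (x , y) ∷ []) (h (x , y) ∷ []) (map g u) (map h u))

  tensor : Bisemimodule A C (x ⊔ y) (b ⊔ x ⊔ ℓx ⊔ y ⊔ ℓy)
  tensor = record
    { Carrierᴹ = FormalSum
    ; _≈ᴹ_     = _∼_
    ; _+ᴹ_     = _++_
    ; _*ₗ_     = _·ₗ_
    ; _*ᵣ_     = _·ᵣ_
    ; 0ᴹ       = []
    ; isBisemimodule = record
      { +ᴹ-isCommutativeMonoid = record
        { isMonoid = record
          { isSemigroup = record
            { isMagma = record
              { isEquivalence = record
                { refl = ∼-refl ; sym = ∼-sym ; trans = ∼-trans }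
              ; ∙-cong = ++-cong
              }
            ; assoc = λ u v w → ∼-reflexive (++-assoc u v w)
            }
          ; identity = (λ u → ∼-refl) , (λ u → ∼-reflexive (++-identityʳ u))
          }
        ; comm = ++-comm
        }
      ; isPreleftSemimodule = record
        { *ₗ-cong = λ {a} {a′} {u} {v} a≈a′ u∼v → ∼-trans (·ₗ-congʳ a u∼v)
            (map-∼ (λ x y → ⊗-cong (X.*ₗ-cong a≈a′ X.≈ᴹ-refl) Y.≈ᴹ-refl) v)
        ; *ₗ-zeroˡ = map-∼-zero λ x y →
            ∼-trans (⊗-cong (X.*ₗ-zeroˡ x) Y.≈ᴹ-refl) (⊗-zeroˡ y)
        ; *ₗ-distribʳ = λ u a a′ → map-∼-+ (λ x y →
            ∼-trans (⊗-cong (X.*ₗ-distribʳ x a a′) Y.≈ᴹ-refl) (⊗-addˡ _ _ y)) u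
        ; *ₗ-identityˡ = map-∼-id λ x y → ⊗-cong (X.*ₗ-identityˡ x) Y.≈ᴹ-refl
        ; *ₗ-assoc = λ a a′ → map-∼-∘ λ x y →
            ⊗-cong (X.*ₗ-assoc a a′ x) Y.≈ᴹ-refl
        ; *ₗ-zeroʳ = λ a → ∼-refl
        ; *ₗ-distribˡ = λ a u v → ∼-reflexive (map-++ _ u v)
        }
      ; isPrerightSemimodule = record
        { *ᵣ-cong = λ {u} {v} {c} {c′} u∼v c≈c′ → ∼-trans (·ᵣ-congˡ c u∼v)
            (map-∼ (λ x y → ⊗-cong X.≈ᴹ-refl (Y.*ᵣ-cong Y.≈ᴹ-refl c≈c′)) v)
        ; *ᵣ-zeroʳ = map-∼-zero λ x y →
            ∼-trans (⊗-cong X.≈ᴹ-refl (Y.*ᵣ-zeroʳ y)) (⊗-zeroʳ x)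
        ; *ᵣ-distribˡ = λ u c c′ → map-∼-+ (λ x y →
            ∼-trans (⊗-cong X.≈ᴹ-refl (Y.*ᵣ-distribˡ y c c′)) (⊗-addʳ x _ _)) u
        ; *ᵣ-identityʳ = map-∼-id λ x y → ⊗-cong X.≈ᴹ-refl (Y.*ᵣ-identityʳ y)
        ; *ᵣ-assoc = λ u c c′ → ∼-sym (map-∼-∘ (λ x y →
            ⊗-cong X.≈ᴹ-refl (Y.≈ᴹ-sym (Y.*ᵣ-assoc y c c′))) u)
        ; *ᵣ-zeroˡ = λ c → ∼-refl
        ; *ᵣ-distribʳ = λ c u v → ∼-reflexive (map-++ _ u v)
        }
      ; *ₗ-*ᵣ-assoc = λ a u c → commute a c u
      }
    }
    where
    commute : ∀ a c u → ((a ·ₗ u) ·ᵣ c) ∼ (a ·ₗ (u ·ᵣ c))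
    commute a c []      = ∼-refl
    commute a c (_ ∷ u) = ++-cong ∼-refl (commute a c u)

open Tensor public using (tensor)

------------------------------------------------------------------------
-- Morita equivalence

record MoritaEquivalent {c ℓ c′ ℓ′ : Level}
                        (K : KleeneAlgebra c ℓ) (S : KleeneAlgebra c′ ℓ′)
                        (x ℓx y ℓy : Level)
                        : Set (c ⊔ ℓ ⊔ c′ ⊔ ℓ′ ⊔ lsuc (x ⊔ ℓx ⊔ y ⊔ ℓy)) where
  private
    module K = KleeneAlgebra K
    module S = KleeneAlgebra S

  field
    X : KleeneBimodule K S x ℓx
    Y : KleeneBimodule S K y ℓy

  private
    module X = KleeneBimodule X
    module Y = KleeneBimodule Y

  field
    X⊗Y≅K : tensor X.bisemimodule Y.bisemimodule ≅ᵇ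
            TensorUnit.bisemimodule {R = K.semiring}
    Y⊗X≅S : tensor Y.bisemimodule X.bisemimodule ≅ᵇ
            TensorUnit.bisemimodule {R = S.semiring}

------------------------------------------------------------------------
-- Idempotents, fullness and the semiring eRe

module _ {c ℓ : Level} (R : Semiring c ℓ) where
  open Semiring R
  open AlgebraDefinitions _≈_ using (_IdempotentOn_)
  open SemiringSum R using (sum; sum-syntax)

  IsIdempotentElement : Carrier → Set ℓ
  IsIdempotentElement e = _*_ IdempotentOn e

  infix 4 _∈-ideal_

  -- x ∈-ideal e says that x lies in ReR.
  _∈-ideal_ : Carrier → Carrier → Set (c ⊔ ℓ)
  x ∈-ideal e = ∃ λ n → Σ (Vector Carrier n) λ r → Σ (Vector Carrier n) λ s →
    x ≈ ∑[ i < n ] (r i * e * s i)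

  -- Only R ⊆ ReR is stated; ReR ⊆ R always holds.
  IsFull : Carrier → Set (c ⊔ ℓ)
  IsFull e = ∀ x → x ∈-ideal e

  corner : (e : Carrier) → IsIdempotentElement e → Semiring (c ⊔ ℓ) ℓ
  corner e ee≈e = record
    { Carrier = Σ Carrier λ x → ∃ λ r → x ≈ e * r * e
    ; _≈_     = _≈_ on proj₁
    ; _+_     = λ (x , r , p) (y , s , q) → x + y , r + s , +-closed p q
    ; _*_     = λ (x , r , p) (y , s , q) → x * y , r * e * e * s , *-closed p q
    ; 0#      = 0# , 0# , sym (trans (*-congʳ (zeroʳ e)) (zeroˡ e))
    ; 1#      = e , 1# , sym (trans (*-congʳ (*-identityʳ e)) ee≈e)
    ; isSemiring = record
      { isSemiringWithoutAnnihilatingZero = record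
        { +-isCommutativeMonoid = record
          { isMonoid = record
            { isSemigroup = record
              { isMagma = record
                { isEquivalence = record { refl = refl ; sym = sym ; trans = trans }
                ; ∙-cong = +-cong
                }
              ; assoc = λ x y z → +-assoc (proj₁ x) (proj₁ y) (proj₁ z)
              }
            ; identity = (λ x → +-identityˡ (proj₁ x)) , (λ x → +-identityʳ (proj₁ x))
            }
          ; comm = λ x y → +-comm (proj₁ x) (proj₁ y)
          }
        ; *-cong     = *-cong
        ; *-assoc    = λ x y z → *-assoc (proj₁ x) (proj₁ y) (proj₁ z)
        ; *-identity = (λ (_ , _ , p) → e-identityˡ p) , (λ (_ , _ , p) → e-identityʳ p)
        ; distrib    = (λ x y z → distribˡ (proj₁ x) (proj₁ y) (proj₁ z))
                     , (λ x y z → distribʳ (proj₁ x) (proj₁ y) (proj₁ z))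
        }
      ; zero = (λ x → zeroˡ (proj₁ x)) , (λ x → zeroʳ (proj₁ x))
      }
    }
    where
    open SetoidReasoning setoid

    +-closed : ∀ {x y r s} → x ≈ e * r * e → y ≈ e * s * e →
               x + y ≈ e * (r + s) * e
    +-closed {x} {y} {r} {s} p q = begin
      x + y                  ≈⟨ +-cong p q ⟩
      e * r * e + e * s * e  ≈⟨ distribʳ e (e * r) (e * s) ⟨
      (e * r + e * s) * e    ≈⟨ *-congʳ (distribˡ e r s) ⟨
      e * (r + s) * e        ∎

    *-closed : ∀ {x y r s} → x ≈ e * r * e → y ≈ e * s * e →
               x * y ≈ e * (r * e * e * s) * e
    *-closed {x} {y} {r} {s} p q = begin
      x * y                      ≈⟨ *-cong p q ⟩
      (e * r * e) * (e * s * e)  ≈⟨ *-assoc (e * r * e) (e * s) e ⟨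
      (e * r * e) * (e * s) * e  ≈⟨ *-congʳ (*-assoc (e * r * e) e s) ⟨
      e * r * e * e * s * e      ≈⟨ *-congʳ (*-congʳ (*-congʳ (*-assoc e r e))) ⟩
      e * (r * e) * e * s * e    ≈⟨ *-congʳ (*-congʳ (*-assoc e (r * e) e)) ⟩
      e * (r * e * e) * s * e    ≈⟨ *-congʳ (*-assoc e (r * e * e) s) ⟩
      e * (r * e * e * s) * e    ∎

    e-identityˡ : ∀ {x r} → x ≈ e * r * e → e * x ≈ x
    e-identityˡ {x} {r} p = begin
      e * x            ≈⟨ *-congˡ p ⟩
      e * (e * r * e)  ≈⟨ *-assoc e (e * r) e ⟨
      e * (e * r) * e  ≈⟨ *-congʳ (*-assoc e e r) ⟨
      e * e * r * e    ≈⟨ *-congʳ (*-congʳ ee≈e) ⟩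
      e * r * e        ≈⟨ p ⟨
      x                ∎

    e-identityʳ : ∀ {x r} → x ≈ e * r * e → x * e ≈ x
    e-identityʳ {x} {r} p = begin
      x * e            ≈⟨ *-congʳ p ⟩
      e * r * e * e    ≈⟨ *-assoc (e * r) e e ⟩
      e * r * (e * e)  ≈⟨ *-congˡ ee≈e ⟩
      e * r * e        ≈⟨ p ⟨
      x                ∎

------------------------------------------------------------------------
-- Square matrices

module _ {c ℓ : Level} (R : Semiring c ℓ) (n : ℕ) where
  open Semiring R
  open SemiringSum R

  private
    δ : ∀ {m} → Fin m → Fin m → Carrier
    δ i j = if does (i ≟ j) then 1# else 0#

    sum-zero : ∀ {m} (v : Vector Carrier m) → (∀ i → v i ≈ 0#) → sum v ≈ 0#
    sum-zero {m} v p = trans (sum-cong-≋ p) (sum-replicate-zero m)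

    sum-δˡ : ∀ {m} (i : Fin m) (v : Vector Carrier m) →
             ∑[ k < m ] (δ i k * v k) ≈ v i
    sum-δˡ zero v =
      trans (+-cong (*-identityˡ _) (sum-zero _ λ k → zeroˡ (v (suc k))))
            (+-identityʳ _)
    sum-δˡ (suc i) v =
      trans (+-cong (zeroˡ _) (sum-δˡ i (λ k → v (suc k)))) (+-identityˡ _)

    sum-δʳ : ∀ {m} (j : Fin m) (v : Vector Carrier m) →
             ∑[ k < m ] (v k * δ k j) ≈ v j
    sum-δʳ zero v =
      trans (+-cong (*-identityʳ _) (sum-zero _ λ k → zeroʳ (v (suc k))))
            (+-identityʳ _)
    sum-δʳ (suc j) v =
      trans (+-cong (zeroʳ _) (sum-δʳ j (λ k → v (suc k)))) (+-identityˡ _)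

    open SetoidReasoning setoid

    mul-assoc : ∀ (P Q T : Fin n → Fin n → Carrier) i j →
      ∑[ k < n ] ((∑[ l < n ] (P i l * Q l k)) * T k j) ≈
      ∑[ l < n ] (P i l * (∑[ k < n ] (Q l k * T k j)))
    mul-assoc P Q T i j = begin
      ∑[ k < n ] ((∑[ l < n ] (P i l * Q l k)) * T k j)
        ≈⟨ sum-cong-≋ (λ k → *-distribʳ-sum (T k j) (λ l → P i l * Q l k)) ⟩
      ∑[ k < n ] (∑[ l < n ] (P i l * Q l k * T k j))
        ≈⟨ ∑-comm (λ k l → P i l * Q l k * T k j) ⟩
      ∑[ l < n ] (∑[ k < n ] (P i l * Q l k * T k j))
        ≈⟨ sum-cong-≋ (λ l → sum-cong-≋ (λ k → *-assoc (P i l) (Q l k) (T k j))) ⟩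
      ∑[ l < n ] (∑[ k < n ] (P i l * (Q l k * T k j)))
        ≈⟨ sum-cong-≋ (λ l → *-distribˡ-sum (P i l) (λ k → Q l k * T k j)) ⟨
      ∑[ l < n ] (P i l * (∑[ k < n ] (Q l k * T k j)))
        ∎

  matrixSemiring : Semiring c ℓ
  matrixSemiring = record
    { Carrier = Fin n → Fin n → Carrier
    ; _≈_     = λ P Q → ∀ i j → P i j ≈ Q i j
    ; _+_     = λ P Q i j → P i j + Q i j
    ; _*_     = λ P Q i j → ∑[ k < n ] (P i k * Q k j)
    ; 0#      = λ i j → 0#
    ; 1#      = δ
    ; isSemiring = record
      { isSemiringWithoutAnnihilatingZero = record
        { +-isCommutativeMonoid = record
          { isMonoid = record
            { isSemigroup = record
              { isMagma = record
                { isEquivalence = record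
                  { refl  = λ i j → refl
                  ; sym   = λ p i j → sym (p i j)
                  ; trans = λ p q i j → trans (p i j) (q i j)
                  }
                ; ∙-cong = λ p q i j → +-cong (p i j) (q i j)
                }
              ; assoc = λ P Q T i j → +-assoc (P i j) (Q i j) (T i j)
              }
            ; identity = (λ P i j → +-identityˡ (P i j)) , (λ P i j → +-identityʳ (P i j))
            }
          ; comm = λ P Q i j → +-comm (P i j) (Q i j)
          }
        ; *-cong     = λ p q i j → sum-cong-≋ (λ k → *-cong (p i k) (q k j))
        ; *-assoc    = mul-assoc
        ; *-identity = (λ P i j → sum-δˡ i (λ k → P k j))
                     , (λ P i j → sum-δʳ j (P i))
        ; distrib    =
            (λ P Q T i j → trans
              (sum-cong-≋ (λ k → distribˡ (P i k) (Q k j) (T k j)))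
              (∑-distrib-+ (λ k → P i k * Q k j) (λ k → P i k * T k j)))
          , (λ P Q T i j → trans
              (sum-cong-≋ (λ k → distribʳ (P k j) (Q i k) (T i k)))
              (∑-distrib-+ (λ k → Q i k * P k j) (λ k → T i k * P k j)))
        }
      ; zero = (λ P i j → sum-zero _ (λ k → zeroˡ (P k j)))
             , (λ P i j → sum-zero _ (λ k → zeroʳ (P i k)))
      }
    }

-- Write f : X ⊗ Y → K and g : Y ⊗ X → S for the two isomorphisms.  The maps
-- x ⊗ y ⊗ x′ ↦ f (x ⊗ y) x′ and x ⊗ y ⊗ x′ ↦ x g (y ⊗ x′) need not agree, but they
-- differ by an endomorphism α of X with a right inverse β; replacing f (x ⊗ y) by
-- f (β x ⊗ y) makes them agree.  If 1 = Σⱼ g (yⱼ ⊗ xⱼ), then ξⱼ = f (β (-) ⊗ yⱼ) are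
-- coordinates with respect to the generators xⱼ of the left K-module X, so that X is
-- the image of the idempotent matrix e = (ξⱼ xᵢ), and S acts on X as eMe.  Fullness
-- of e expresses that the linear functionals on X generate K, which holds because f
-- is surjective.

module Submission where

open import Defs
open import Algebra.Bundles using (CommutativeMonoid; Monoid; Semiring)
open import Algebra.Module.Bundles using (Bisemimodule)
import Algebra.Module.Construct.TensorUnit as TensorUnit
open import Algebra.Module.Morphism.Structures
  using ( IsLeftSemimoduleHomomorphism; IsRightSemimoduleHomomorphism
        ; IsBisemimoduleIsomorphism)
open import Algebra.Morphism.Structures using (IsMonoidHomomorphism)
import Algebra.Properties.CommutativeMonoid.Sum as CommutativeMonoidSum
import Algebra.Properties.Monoid.Sum as MonoidSum
import Algebra.Properties.Semiring.Sum as SemiringSum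
open import Data.Fin.Base using (Fin; zero; suc)
open import Data.List.Base using ([]; _∷_; _++_; length; lookup)
open import Data.Nat.Base using (ℕ; zero; suc; _<_; z≤n; s≤s)
open import Data.Product.Base using (Σ; _×_; _,_; proj₁; proj₂; ∃)
open import Data.Vec.Functional as Vector using (Vector)
open import Function.Base using (_∘_)
open import Level using (Level; _⊔_)
import Relation.Binary.Reasoning.Setoid as SetoidReasoning

-- Finite sums

module _ {m ℓm n ℓn : Level} (M : Monoid m ℓm) (N : Monoid n ℓn) where
  private
    module M = Monoid M
    module N = Monoid N
  open MonoidSum using (sum)

  sum-homo : ∀ {F : M.Carrier → N.Carrier} →
             IsMonoidHomomorphism M.rawMonoid N.rawMonoid F →
             ∀ {k} (v : Vector M.Carrier k) → F (sum M v) N.≈ sum N (F ∘ v)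
  sum-homo F-homo {zero}  v = IsMonoidHomomorphism.ε-homo F-homo
  sum-homo F-homo {suc k} v =
    N.trans (IsMonoidHomomorphism.homo F-homo _ _)
            (N.∙-congˡ (sum-homo F-homo (v ∘ suc)))

  isMonoidHomomorphism : ∀ {F : M.Carrier → N.Carrier} →
    (∀ {x y} → x M.≈ y → F x N.≈ F y) →
    (∀ x y → F (x M.∙ y) N.≈ F x N.∙ F y) →
    F M.ε N.≈ N.ε →
    IsMonoidHomomorphism M.rawMonoid N.rawMonoid F
  isMonoidHomomorphism cong homo ε-homo = record
    { isMagmaHomomorphism = record { isRelHomomorphism = record { cong = cong } ; homo = homo }
    ; ε-homo              = ε-homo
    }

module BisemimoduleSum {r ℓr s ℓs x ℓx : Level} {R : Semiring r ℓr} {S : Semiring s ℓs}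
                       (X : Bisemimodule R S x ℓx) where
  private
    module R = Semiring R
    module S = Semiring S
  open Bisemimodule X
  open CommutativeMonoidSum +ᴹ-commutativeMonoid public
  open SemiringSum R using () renaming (sum to sumᴿ)
  open SemiringSum S using () renaming (sum to sumˢ)

  *ₗ-distribˡ-sum : ∀ {k} a (v : Vector Carrierᴹ k) → a *ₗ sum v ≈ᴹ sum (λ i → a *ₗ v i)
  *ₗ-distribˡ-sum a = sum-homo +ᴹ-monoid +ᴹ-monoid
    (isMonoidHomomorphism +ᴹ-monoid +ᴹ-monoid (*ₗ-cong R.refl) (*ₗ-distribˡ a) (*ₗ-zeroʳ a))

  *ₗ-distribʳ-sum : ∀ {k} (a : Vector R.Carrier k) z → sumᴿ a *ₗ z ≈ᴹ sum (λ i → a i *ₗ z)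
  *ₗ-distribʳ-sum a z = sum-homo R.+-monoid +ᴹ-monoid
    (isMonoidHomomorphism R.+-monoid +ᴹ-monoid
      (λ p → *ₗ-cong p ≈ᴹ-refl) (*ₗ-distribʳ z) (*ₗ-zeroˡ z)) a

  *ᵣ-distribˡ-sum : ∀ {k} z (b : Vector S.Carrier k) → z *ᵣ sumˢ b ≈ᴹ sum (λ i → z *ᵣ b i)
  *ᵣ-distribˡ-sum z = sum-homo S.+-monoid +ᴹ-monoid
    (isMonoidHomomorphism S.+-monoid +ᴹ-monoid (*ᵣ-cong ≈ᴹ-refl) (*ᵣ-distribˡ z) (*ᵣ-zeroʳ z))

-- The ideal generated by an element

module _ {c ℓ : Level} (R : Semiring c ℓ) {e : Semiring.Carrier R} where
  open Semiring R hiding (zero)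
  open SemiringSum R using (sum)

  private
    infix 4 _∈ReR
    _∈ReR : Carrier → Set (c ⊔ ℓ)
    _∈ReR x = _∈-ideal_ R x e

  ∈-ideal-resp-≈ : ∀ {x y} → x ≈ y → y ∈ReR → x ∈ReR
  ∈-ideal-resp-≈ x≈y (n , r , s , y≈) = n , r , s , trans x≈y y≈

  ∈-ideal-0 : 0# ∈ReR
  ∈-ideal-0 = 0 , Vector.[] , Vector.[] , refl

  ∈-ideal-gen : ∀ r s → r * e * s ∈ReR
  ∈-ideal-gen r s = 1 , r Vector.∷ Vector.[] , s Vector.∷ Vector.[] , sym (+-identityʳ _)

  ∈-ideal-+ : ∀ {x y} → x ∈ReR → y ∈ReR → x + y ∈ReR
  ∈-ideal-+ {x} {y} (n , r , s , x≈) y∈ = go n r s x≈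
    where
    -- `x` is generalised so that the recursive call can take the tail sum itself, with `refl` as
    -- its equation.
    go : ∀ n (r s : Vector Carrier n) {x} → x ≈ sum (λ i → r i * e * s i) → x + y ∈ReR
    go zero    r s x≈ = ∈-ideal-resp-≈ (trans (+-congʳ x≈) (+-identityˡ y)) y∈
    go (suc n) r s x≈ =
      let (m , r′ , s′ , q) = go n (r ∘ suc) (s ∘ suc) refl in
      suc m , r zero Vector.∷ r′ , s zero Vector.∷ s′ ,
      trans (+-congʳ x≈) (trans (+-assoc _ _ _) (+-congˡ q))

  -- Applied twice, this puts a doubly indexed sum of generators in the ideal without reindexing it
  -- over a single `Fin`.
  ∈-ideal-sum : ∀ {k} (v : Vector Carrier k) → (∀ i → v i ∈ReR) → sum v ∈ReR
  ∈-ideal-sum {zero}  v v∈ = ∈-ideal-0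
  ∈-ideal-sum {suc k} v v∈ = ∈-ideal-+ (v∈ zero) (∈-ideal-sum (v ∘ suc) (v∈ ∘ suc))

module _ {c ℓ : Level} (R : Semiring c ℓ) (n : ℕ) where
  private
    module R = Semiring R
    module M = Semiring (matrixSemiring R n)
  open SemiringSum using (sum)

  sum-entry : ∀ {k} (P : Vector M.Carrier k) i j →
              sum (matrixSemiring R n) P i j R.≈ sum R (λ l → P l i j)
  sum-entry P i j = sum-homo M.+-monoid R.+-monoid
    (isMonoidHomomorphism M.+-monoid R.+-monoid (λ p → p i j) (λ _ _ → R.refl) R.refl) P

-- Bimodules with compatible coordinates

module _ {r ℓr s ℓs x ℓx : Level} {R : Semiring r ℓr} {S : Semiring s ℓs}
         (X : Bisemimodule R S x ℓx) where
  private
    module R = Semiring R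
    module S = Semiring S
  open Bisemimodule X

  IsLeftFunctional : (Carrierᴹ → R.Carrier) → Set (r ⊔ ℓr ⊔ x ⊔ ℓx)
  IsLeftFunctional = IsLeftSemimoduleHomomorphism
    rawLeftSemimodule (TensorUnit.rawLeftSemimodule {R = R.rawSemiring})

  IsRightFunctional : (Carrierᴹ → S.Carrier) → Set (s ⊔ ℓs ⊔ x ⊔ ℓx)
  IsRightFunctional = IsRightSemimoduleHomomorphism
    rawRightSemimodule (TensorUnit.rawRightSemimodule {R = S.rawSemiring})

-- Linearity of ξ is not a field: it follows from ξ-η, as K acts faithfully on X.

record DualBasis {k ℓk s ℓs x ℓx : Level} {K : Semiring k ℓk} {S : Semiring s ℓs}
                 (X : Bisemimodule K S x ℓx) : Set (k ⊔ ℓk ⊔ s ⊔ ℓs ⊔ x ⊔ ℓx) where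
  private
    module K = Semiring K
    module S = Semiring S
  open Bisemimodule X

  field
    {rank}   : ℕ
    gen      : Vector Carrierᴹ rank
    ξ        : Fin rank → Carrierᴹ → K.Carrier
    η        : Fin rank → Carrierᴹ → S.Carrier
    η-homo   : ∀ j → IsRightFunctional X (η j)
    ξ-η      : ∀ j z z′ → ξ j z *ₗ z′ ≈ᴹ z *ᵣ η j z′
    η-gen    : SemiringSum.sum S (λ j → η j (gen j)) S.≈ S.1#
    {size}   : ℕ
    point    : Vector Carrierᴹ size
    ζ        : Fin size → Carrierᴹ → K.Carrier
    ζ-homo   : ∀ i → IsLeftFunctional X (ζ i)
    ζ-point  : SemiringSum.sum K (λ i → ζ i (point i)) K.≈ K.1#

module _ {k ℓk s ℓs x ℓx : Level} {K : Semiring k ℓk} {S : Semiring s ℓs}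
         {X : Bisemimodule K S x ℓx} (B : DualBasis X) where
  private
    module K = Semiring K
    module S = Semiring S
    module η j = IsRightSemimoduleHomomorphism (DualBasis.η-homo B j)
    module ζ i = IsLeftSemimoduleHomomorphism (DualBasis.ζ-homo B i)
  open Bisemimodule X
  open DualBasis B
  open BisemimoduleSum X
  private
    M = matrixSemiring K rank
    module M = Semiring M
    module ΣK = SemiringSum K
    module ΣS = SemiringSum S
    module ΣM = SemiringSum M

  -- Expansion in the generators and faithfulness of the left action

  expand : ∀ z → z ≈ᴹ sum (λ j → ξ j z *ₗ gen j)
  expand z = begin
    z                                         ≈⟨ *ᵣ-identityʳ z ⟨
    z *ᵣ S.1#                                 ≈⟨ *ᵣ-cong ≈ᴹ-refl η-gen ⟨
    z *ᵣ ΣS.sum (λ j → η j (gen j))           ≈⟨ *ᵣ-distribˡ-sum z (λ j → η j (gen j)) ⟩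
    sum (λ j → z *ᵣ η j (gen j))              ≈⟨ sum-cong-≋ (λ j → ξ-η j z (gen j)) ⟨
    sum (λ j → ξ j z *ₗ gen j)                ∎
    where open SetoidReasoning ≈ᴹ-setoid

  -- A left functional is determined by its values on the generators. The right-hand side has the
  -- shape of a matrix product entry, so the matrix identities below are instances of this one for
  -- suitable `F`.
  expand-linear : ∀ {F} → IsLeftFunctional X F → ∀ z → F z K.≈ ΣK.sum (λ j → ξ j z K.* F (gen j))
  expand-linear {F} F-linear z = begin
    F z                                       ≈⟨ F.⟦⟧-cong (expand z) ⟩
    F (sum (λ j → ξ j z *ₗ gen j))
      ≈⟨ sum-homo +ᴹ-monoid K.+-monoid F.+ᴹ-isMonoidHomomorphism (λ j → ξ j z *ₗ gen j) ⟩
    ΣK.sum (λ j → F (ξ j z *ₗ gen j))         ≈⟨ ΣK.sum-cong-≋ (λ j → F.*ₗ-homo (ξ j z) (gen j)) ⟩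
    ΣK.sum (λ j → ξ j z K.* F (gen j))        ∎
    where
    open SetoidReasoning K.setoid
    module F = IsLeftSemimoduleHomomorphism F-linear

  -- Multiplying `ζ-point` by `a` and moving `a` inside each `ζ i` recovers a scalar from its action
  -- on the points, whence `*ₗ-faithful`.
  scalar-as-sum : ∀ a → a K.≈ ΣK.sum (λ i → ζ i (a *ₗ point i))
  scalar-as-sum a = begin
    a                                         ≈⟨ K.*-identityʳ a ⟨
    a K.* K.1#                                ≈⟨ K.*-congˡ ζ-point ⟨
    a K.* ΣK.sum (λ i → ζ i (point i))        ≈⟨ ΣK.*-distribˡ-sum a (λ i → ζ i (point i)) ⟩
    ΣK.sum (λ i → a K.* ζ i (point i))        ≈⟨ ΣK.sum-cong-≋ (λ i → ζ.*ₗ-homo i a (point i)) ⟨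
    ΣK.sum (λ i → ζ i (a *ₗ point i))         ∎
    where open SetoidReasoning K.setoid

  *ₗ-faithful : ∀ {a b} → (∀ z → a *ₗ z ≈ᴹ b *ₗ z) → a K.≈ b
  *ₗ-faithful p = K.trans (scalar-as-sum _)
    (K.trans (ΣK.sum-cong-≋ (λ i → ζ.⟦⟧-cong i (p (point i)))) (K.sym (scalar-as-sum _)))

  -- By faithfulness it suffices to let both sides act on `w`. Then `ξ-η` replaces `ξ j z *ₗ w` by
  -- `z *ᵣ η j w`, whose left linearity in `z` is part of the bimodule laws.
  ξ-linear : ∀ j → IsLeftFunctional X (ξ j)
  ξ-linear j = record
    { +ᴹ-isMonoidHomomorphism = isMonoidHomomorphism +ᴹ-monoid K.+-monoid
        (λ {z} {z′} p → *ₗ-faithful λ w → begin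
          ξ j z *ₗ w                   ≈⟨ ξ-η j z w ⟩
          z *ᵣ η j w                   ≈⟨ *ᵣ-cong p S.refl ⟩
          z′ *ᵣ η j w                  ≈⟨ ξ-η j z′ w ⟨
          ξ j z′ *ₗ w                  ∎)
        (λ z z′ → *ₗ-faithful λ w → begin
          ξ j (z +ᴹ z′) *ₗ w           ≈⟨ ξ-η j (z +ᴹ z′) w ⟩
          (z +ᴹ z′) *ᵣ η j w           ≈⟨ *ᵣ-distribʳ (η j w) z z′ ⟩
          z *ᵣ η j w +ᴹ z′ *ᵣ η j w    ≈⟨ +ᴹ-cong (ξ-η j z w) (ξ-η j z′ w) ⟨
          ξ j z *ₗ w +ᴹ ξ j z′ *ₗ w    ≈⟨ *ₗ-distribʳ w (ξ j z) (ξ j z′) ⟨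
          (ξ j z K.+ ξ j z′) *ₗ w      ∎)
        (*ₗ-faithful λ w → begin
          ξ j 0ᴹ *ₗ w                  ≈⟨ ξ-η j 0ᴹ w ⟩
          0ᴹ *ᵣ η j w                  ≈⟨ *ᵣ-zeroˡ (η j w) ⟩
          0ᴹ                           ≈⟨ *ₗ-zeroˡ w ⟨
          K.0# *ₗ w                    ∎)
    ; *ₗ-homo = λ a z → *ₗ-faithful λ w → begin
        ξ j (a *ₗ z) *ₗ w              ≈⟨ ξ-η j (a *ₗ z) w ⟩
        (a *ₗ z) *ᵣ η j w              ≈⟨ *ₗ-*ᵣ-assoc a z (η j w) ⟩
        a *ₗ (z *ᵣ η j w)              ≈⟨ *ₗ-cong K.refl (ξ-η j z w) ⟨
        a *ₗ (ξ j z *ₗ w)              ≈⟨ *ₗ-assoc a (ξ j z) w ⟨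
        (a K.* ξ j z) *ₗ w             ∎
    }
    where open SetoidReasoning ≈ᴹ-setoid

  private module ξ j = IsLeftSemimoduleHomomorphism (ξ-linear j)

  ξ-*ᵣ-linear : ∀ j t → IsLeftFunctional X (λ z → ξ j (z *ᵣ t))
  ξ-*ᵣ-linear j t = record
    { +ᴹ-isMonoidHomomorphism = isMonoidHomomorphism +ᴹ-monoid K.+-monoid
        (λ p → ξ.⟦⟧-cong j (*ᵣ-cong p S.refl))
        (λ z z′ → K.trans (ξ.⟦⟧-cong j (*ᵣ-distribʳ t z z′)) (ξ.+ᴹ-homo j _ _))
        (K.trans (ξ.⟦⟧-cong j (*ᵣ-zeroˡ t)) (ξ.0ᴹ-homo j))
    ; *ₗ-homo = λ a z → K.trans (ξ.⟦⟧-cong j (*ₗ-*ᵣ-assoc a z t)) (ξ.*ₗ-homo j a _)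
    }

  -- The Gram matrix and the representation of `S` by matrices

  gramMatrix : M.Carrier
  gramMatrix i j = ξ j (gen i)

  private e = gramMatrix

  -- Coordinates are written as rows, so that the right action of `S` becomes right multiplication
  -- of matrices and the order of products is preserved.
  action : S.Carrier → M.Carrier
  action s i j = ξ j (gen i *ᵣ s)

  action-cong : ∀ {s t} → s S.≈ t → action s M.≈ action t
  action-cong p i j = ξ.⟦⟧-cong j (*ᵣ-cong ≈ᴹ-refl p)

  -- Expanding the functional that sends `z` to `ξ j (z *ᵣ t)` at the point `gen i *ᵣ s` gives
  -- exactly the entry of the matrix product.
  action-* : ∀ s t → action (s S.* t) M.≈ action s M.* action t
  action-* s t i j = K.trans (ξ.⟦⟧-cong j (≈ᴹ-sym (*ᵣ-assoc (gen i) s t)))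
                             (expand-linear (ξ-*ᵣ-linear j t) (gen i *ᵣ s))

  action-1 : action S.1# M.≈ e
  action-1 i j = ξ.⟦⟧-cong j (*ᵣ-identityʳ (gen i))

  gramMatrix-idem : IsIdempotentElement M e
  gramMatrix-idem i j = K.sym (expand-linear (ξ-linear j) (gen i))

  action-∈-corner : ∀ s → action s M.≈ e M.* action s M.* e
  action-∈-corner s = begin
    action s                                ≈⟨ action-cong (S.*-identityʳ s) ⟨
    action (s S.* S.1#)                     ≈⟨ action-* s S.1# ⟩
    action s M.* action S.1#                ≈⟨ M.*-cong (action-cong (S.sym (S.*-identityˡ s))) action-1 ⟩
    action (S.1# S.* s) M.* e               ≈⟨ M.*-congʳ {x = e} (action-* S.1# s) ⟩
    action S.1# M.* action s M.* e          ≈⟨ M.*-congʳ {x = e} (M.*-congʳ {x = action s} action-1) ⟩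
    e M.* action s M.* e                    ∎
    where open SetoidReasoning M.setoid

  private
    C = corner M e gramMatrix-idem
    module C = Semiring C

  -- By `expand`, the matrix of `s` determines every `gen i *ᵣ s`; by `η-gen` and right linearity of
  -- `η`, these elements determine `s`.
  action-injective : ∀ {s t} → action s M.≈ action t → s S.≈ t
  action-injective {s} {t} p = begin
    s                                        ≈⟨ coordinates s ⟩
    ΣS.sum (λ i → η i (gen i *ᵣ s))          ≈⟨ ΣS.sum-cong-≋ (λ i → η.⟦⟧-cong i (gen-*ᵣ i)) ⟩
    ΣS.sum (λ i → η i (gen i *ᵣ t))          ≈⟨ coordinates t ⟨
    t                                        ∎
    where
    open SetoidReasoning S.setoid

    coordinates : ∀ s → s S.≈ ΣS.sum (λ i → η i (gen i *ᵣ s))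
    coordinates s = begin
      s                                      ≈⟨ S.*-identityˡ s ⟨
      S.1# S.* s                             ≈⟨ S.*-congʳ η-gen ⟨
      ΣS.sum (λ i → η i (gen i)) S.* s       ≈⟨ ΣS.*-distribʳ-sum s (λ i → η i (gen i)) ⟩
      ΣS.sum (λ i → η i (gen i) S.* s)       ≈⟨ ΣS.sum-cong-≋ (λ i → η.*ᵣ-homo i s (gen i)) ⟨
      ΣS.sum (λ i → η i (gen i *ᵣ s))        ∎

    gen-*ᵣ : ∀ i → gen i *ᵣ s ≈ᴹ gen i *ᵣ t
    gen-*ᵣ i = ≈ᴹ-trans (expand (gen i *ᵣ s))
      (≈ᴹ-trans (sum-cong-≋ (λ j → *ₗ-cong (p i j) ≈ᴹ-refl)) (≈ᴹ-sym (expand (gen i *ᵣ t))))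

  action-surjective : ∀ (a : C.Carrier) → ∃ λ s → action s M.≈ proj₁ a
  action-surjective a@(A , _) = σ , λ i j → begin
    ξ j (gen i *ᵣ σ)                         ≈⟨ ξ.⟦⟧-cong j (gen-*ᵣ-σ i) ⟩
    ξ j (row i)
      ≈⟨ sum-homo +ᴹ-monoid K.+-monoid (ξ.+ᴹ-isMonoidHomomorphism j) (λ l → A i l *ₗ gen l) ⟩
    ΣK.sum (λ l → ξ j (A i l *ₗ gen l))      ≈⟨ ΣK.sum-cong-≋ (λ l → ξ.*ₗ-homo j (A i l) (gen l)) ⟩
    (A M.* e) i j                            ≈⟨ C.*-identityʳ a i j ⟩
    A i j                                    ∎
    where
    row : Vector Carrierᴹ rank
    row i = sum (λ l → A i l *ₗ gen l)

    -- `row i` is where an element with matrix `A` must send `gen i`, so the formula `coordinates`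
    -- from `action-injective` forces this choice.
    σ : S.Carrier
    σ = ΣS.sum (λ i → η i (row i))

    -- Trading `η` for `ξ` by `ξ-η` turns the left side into row `i` of `e M.* A` applied to the
    -- generators, and `e` is a left identity on the corner. That it is also a right identity gives
    -- the entries of `action σ`.
    gen-*ᵣ-σ : ∀ i → gen i *ᵣ σ ≈ᴹ row i
    gen-*ᵣ-σ i = begin
      gen i *ᵣ σ
        ≈⟨ *ᵣ-distribˡ-sum (gen i) (λ m → η m (row m)) ⟩
      sum (λ m → gen i *ᵣ η m (row m))
        ≈⟨ sum-cong-≋ (λ m → ξ-η m (gen i) (row m)) ⟨
      sum (λ m → e i m *ₗ row m)
        ≈⟨ sum-cong-≋ (λ m → *ₗ-distribˡ-sum (e i m) (λ l → A m l *ₗ gen l)) ⟩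
      sum (λ m → sum (λ l → e i m *ₗ (A m l *ₗ gen l)))
        ≈⟨ ∑-comm (λ m l → e i m *ₗ (A m l *ₗ gen l)) ⟩
      sum (λ l → sum (λ m → e i m *ₗ (A m l *ₗ gen l)))
        ≈⟨ sum-cong-≋ (λ l → sum-cong-≋ (λ m → *ₗ-assoc (e i m) (A m l) (gen l))) ⟨
      sum (λ l → sum (λ m → (e i m K.* A m l) *ₗ gen l))
        ≈⟨ sum-cong-≋ (λ l → *ₗ-distribʳ-sum (λ m → e i m K.* A m l) (gen l)) ⟨
      sum (λ l → (e M.* A) i l *ₗ gen l)
        ≈⟨ sum-cong-≋ (λ l → *ₗ-cong (C.*-identityˡ a i l) ≈ᴹ-refl) ⟩
      row i
        ∎
      where open SetoidReasoning ≈ᴹ-setoid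

    open SetoidReasoning K.setoid

  -- Row `c` of `T` equals the sum over `i` of its multiples by `ζ i (point i)`. Each of these
  -- scalars is a row of coordinates times a column of values on the generators, and such a product
  -- can be made to pass through `e`.
  gramMatrix-full : IsFull M e
  gramMatrix-full T = ∈-ideal-resp-≈ M T≈
    (∈-ideal-sum M (λ c → ΣM.sum (λ i → P c i M.* e M.* Q c i)) λ c →
     ∈-ideal-sum M (λ i → P c i M.* e M.* Q c i) λ i →
     ∈-ideal-gen M (P c i) (Q c i))
    where
    open SetoidReasoning K.setoid

    -- `P c i` carries the coordinates of `point i` in row `c` and zeros elsewhere. `Q c i` is the
    -- column of values of `ζ i` on the generators times row `c` of `T`.
    P Q : Fin rank → Fin size → M.Carrier
    P c i a j = M.1# a c K.* ξ j (point i)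
    Q c i l b = ζ i (gen l) K.* T c b

    -- Multiplication by `e` fixes rows of coordinates, which is `row`; expanding `ζ i` at `point i`
    -- then collapses the remaining sum.
    PeQ : ∀ c i a b → (P c i M.* e M.* Q c i) a b K.≈ M.1# a c K.* (ζ i (point i) K.* T c b)
    PeQ c i a b = begin
      ΣK.sum (λ l → ΣK.sum (λ j → P c i a j K.* e j l) K.* Q c i l b)
        ≈⟨ ΣK.sum-cong-≋ (λ l → K.*-congʳ (row l)) ⟩
      ΣK.sum (λ l → (M.1# a c K.* ξ l (point i)) K.* (ζ i (gen l) K.* T c b))
        ≈⟨ ΣK.sum-cong-≋ (λ l → reassoc (M.1# a c) (ξ l (point i)) (ζ i (gen l)) (T c b)) ⟩
      ΣK.sum (λ l → M.1# a c K.* (ξ l (point i) K.* ζ i (gen l) K.* T c b))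
        ≈⟨ ΣK.*-distribˡ-sum (M.1# a c) (λ l → ξ l (point i) K.* ζ i (gen l) K.* T c b) ⟨
      M.1# a c K.* ΣK.sum (λ l → ξ l (point i) K.* ζ i (gen l) K.* T c b)
        ≈⟨ K.*-congˡ (ΣK.*-distribʳ-sum (T c b) (λ l → ξ l (point i) K.* ζ i (gen l))) ⟨
      M.1# a c K.* (ΣK.sum (λ l → ξ l (point i) K.* ζ i (gen l)) K.* T c b)
        ≈⟨ K.*-congˡ (K.*-congʳ (expand-linear (ζ-homo i) (point i))) ⟨
      M.1# a c K.* (ζ i (point i) K.* T c b)
        ∎
      where
      reassoc : ∀ p q r t → (p K.* q) K.* (r K.* t) K.≈ p K.* (q K.* r K.* t)
      reassoc p q r t = K.trans (K.*-assoc p q (r K.* t)) (K.*-congˡ (K.sym (K.*-assoc q r t)))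

      row : ∀ l → ΣK.sum (λ j → P c i a j K.* e j l) K.≈ M.1# a c K.* ξ l (point i)
      row l = begin
        ΣK.sum (λ j → M.1# a c K.* ξ j (point i) K.* e j l)
          ≈⟨ ΣK.sum-cong-≋ (λ j → K.*-assoc (M.1# a c) (ξ j (point i)) (e j l)) ⟩
        ΣK.sum (λ j → M.1# a c K.* (ξ j (point i) K.* e j l))
          ≈⟨ ΣK.*-distribˡ-sum (M.1# a c) (λ j → ξ j (point i) K.* e j l) ⟨
        M.1# a c K.* ΣK.sum (λ j → ξ j (point i) K.* e j l)
          ≈⟨ K.*-congˡ (expand-linear (ξ-linear l) (point i)) ⟨
        M.1# a c K.* ξ l (point i)
          ∎

    T≈ : T M.≈ ΣM.sum (λ c → ΣM.sum (λ i → P c i M.* e M.* Q c i))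
    T≈ a b = begin
      T a b
        ≈⟨ M.*-identityˡ T a b ⟨
      ΣK.sum (λ c → M.1# a c K.* T c b)
        ≈⟨ ΣK.sum-cong-≋ (λ c → K.*-congˡ (K.trans (K.*-congʳ ζ-point) (K.*-identityˡ (T c b)))) ⟨
      ΣK.sum (λ c → M.1# a c K.* (ΣK.sum (λ i → ζ i (point i)) K.* T c b))
        ≈⟨ ΣK.sum-cong-≋ (λ c → K.*-congˡ (ΣK.*-distribʳ-sum (T c b) (λ i → ζ i (point i)))) ⟩
      ΣK.sum (λ c → M.1# a c K.* ΣK.sum (λ i → ζ i (point i) K.* T c b))
        ≈⟨ ΣK.sum-cong-≋ (λ c → ΣK.*-distribˡ-sum (M.1# a c) (λ i → ζ i (point i) K.* T c b)) ⟩
      ΣK.sum (λ c → ΣK.sum (λ i → M.1# a c K.* (ζ i (point i) K.* T c b)))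
        ≈⟨ ΣK.sum-cong-≋ (λ c → ΣK.sum-cong-≋ (λ i → PeQ c i a b)) ⟨
      ΣK.sum (λ c → ΣK.sum (λ i → (P c i M.* e M.* Q c i) a b))
        ≈⟨ ΣK.sum-cong-≋ (λ c → sum-entry K rank (λ i → P c i M.* e M.* Q c i) a b) ⟨
      ΣK.sum (λ c → ΣM.sum (λ i → P c i M.* e M.* Q c i) a b)
        ≈⟨ sum-entry K rank (λ c → ΣM.sum (λ i → P c i M.* e M.* Q c i)) a b ⟨
      ΣM.sum (λ c → ΣM.sum (λ i → P c i M.* e M.* Q c i)) a b
        ∎

  action-iso : S ≅ˢ C
  -- The second component is the corner witness: `action s` itself serves as the `r` in `e * r * e`.
  action-iso = (λ s → action s , action s , action-∈-corner s) , record
    { isSemiringMonomorphism = record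
      { isSemiringHomomorphism = record
        { isNearSemiringHomomorphism = record
          { +-isMonoidHomomorphism = isMonoidHomomorphism S.+-monoid C.+-monoid
              action-cong
              (λ s t i j → K.trans (ξ.⟦⟧-cong j (*ᵣ-distribˡ (gen i) s t)) (ξ.+ᴹ-homo j _ _))
              (λ i j → K.trans (ξ.⟦⟧-cong j (*ᵣ-zeroʳ (gen i))) (ξ.0ᴹ-homo j))
          ; *-homo = action-*
          }
        ; 1#-homo = action-1
        }
      ; injective = action-injective
      }
    ; surjective = λ a → let (s , p) = action-surjective a in
        s , λ t≈s → M.trans (action-cong t≈s) p
    }

  isFullCorner : 0 < rank →
    Σ ℕ λ n → 0 < n ×
      (let N = matrixSemiring K n in
       Σ (Semiring.Carrier N) λ e → Σ (IsIdempotentElement N e) λ ee≈e →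
         IsFull N e × (S ≅ˢ corner N e ee≈e))
  isFullCorner 0<rank =
    rank , 0<rank , gramMatrix , gramMatrix-idem , gramMatrix-full , action-iso

-- The universal property of the tensor product

module TensorLift {a ℓa b ℓb c ℓc x ℓx y ℓy n ℓn : Level}
                  {A : Semiring a ℓa} {B : Semiring b ℓb} {C : Semiring c ℓc}
                  (X : Bisemimodule A B x ℓx) (Y : Bisemimodule B C y ℓy)
                  (N : CommutativeMonoid n ℓn) where
  private
    module B = Semiring B
    module X = Bisemimodule X
    module Y = Bisemimodule Y
  open CommutativeMonoid N renaming (_∙_ to _+_; ε to 0#; ∙-cong to +-cong)
  open CommutativeMonoidSum N
  open Tensor X Y hiding (tensor)
  open SetoidReasoning setoid

  record IsBalanced (F : X.Carrierᴹ → Y.Carrierᴹ → Carrier)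
         : Set (b ⊔ x ⊔ ℓx ⊔ y ⊔ ℓy ⊔ n ⊔ ℓn) where
    field
      cong  : ∀ {x x′ y y′} → x X.≈ᴹ x′ → y Y.≈ᴹ y′ → F x y ≈ F x′ y′
      +ˡ    : ∀ x x′ y → F (x X.+ᴹ x′) y ≈ F x y + F x′ y
      +ʳ    : ∀ x y y′ → F x (y Y.+ᴹ y′) ≈ F x y + F x y′
      zeroˡ : ∀ y → F X.0ᴹ y ≈ 0#
      zeroʳ : ∀ x → F x Y.0ᴹ ≈ 0#
      bal   : ∀ x b y → F (x X.*ᵣ b) y ≈ F x (b Y.*ₗ y)

  -- Indexing by positions of the list, rather than folding over it, makes the lift of a fixed
  -- formal sum a `Fin`-indexed sum to which the library lemmas on `sum` apply directly.
  lift : (X.Carrierᴹ → Y.Carrierᴹ → Carrier) → FormalSum → Carrier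
  lift F u = sum (λ i → F (proj₁ (lookup u i)) (proj₂ (lookup u i)))

  lift-⊗ : ∀ F x y → lift F (x ⊗ y) ≈ F x y
  lift-⊗ F x y = identityʳ (F x y)

  lift-++ : ∀ F u v → lift F (u ++ v) ≈ lift F u + lift F v
  lift-++ F []            v = sym (identityˡ _)
  lift-++ F ((x , y) ∷ u) v = trans (∙-congˡ (lift-++ F u v)) (sym (assoc _ _ _))

  -- Induction over the generating rules of the congruence. It lets relations in the tensor product
  -- that come from injectivity of `ψ` be evaluated in `X`.
  lift-cong : ∀ {F} → IsBalanced F → ∀ {u v} → u ∼ v → lift F u ≈ lift F v
  lift-cong {F} F-bal = go
    where
    open IsBalanced F-bal

    ⊗⊗ : ∀ x x′ y y′ → F x y + F x′ y′ ≈ lift F (x ⊗ y ++ x′ ⊗ y′)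
    ⊗⊗ x x′ y y′ = ∙-congˡ (sym (identityʳ _))

    go : ∀ {u v} → u ∼ v → lift F u ≈ lift F v
    go ∼-refl                      = refl
    go (∼-sym p)                   = sym (go p)
    go (∼-trans p q)               = trans (go p) (go q)
    go (++-cong {u} {u′} {v} {v′} p q) =
      trans (lift-++ F u v) (trans (+-cong (go p) (go q)) (sym (lift-++ F u′ v′)))
    go (++-comm u v)               =
      trans (lift-++ F u v) (trans (comm _ _) (sym (lift-++ F v u)))
    go (⊗-cong p q)                = ∙-congʳ (cong p q)
    go (⊗-addˡ x x′ y)             = trans (lift-⊗ F _ _) (trans (+ˡ x x′ y) (⊗⊗ x x′ y y))
    go (⊗-addʳ x y y′)             = trans (lift-⊗ F _ _) (trans (+ʳ x y y′) (⊗⊗ x x y y′))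
    go (⊗-zeroˡ y)                 = trans (lift-⊗ F _ _) (zeroˡ y)
    go (⊗-zeroʳ x)                 = trans (lift-⊗ F _ _) (zeroʳ x)
    go (⊗-bal x b y)               = ∙-congʳ (bal x b y)

  -- Used to read the preimages of the two units as finite sums of pairings equal to one.
  homo-as-lift : ∀ {G} →
    IsMonoidHomomorphism (Bisemimodule.+ᴹ-rawMonoid (tensor X Y)) rawMonoid G →
    ∀ u → G u ≈ lift (λ x y → G (x ⊗ y)) u
  homo-as-lift G-homo []            = IsMonoidHomomorphism.ε-homo G-homo
  homo-as-lift G-homo ((x , y) ∷ u) =
    trans (IsMonoidHomomorphism.homo G-homo (x ⊗ y) u) (∙-congˡ (homo-as-lift G-homo u))

-- The coordinates arising from a pair of inverse bimodules

module InverseBimodules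
  {k ℓk s ℓs x ℓx y ℓy : Level} {K : Semiring k ℓk} {S : Semiring s ℓs}
  (X : Bisemimodule K S x ℓx) (Y : Bisemimodule S K y ℓy)
  (X⊗Y≅K : tensor X Y ≅ᵇ TensorUnit.bisemimodule {R = K})
  (Y⊗X≅S : tensor Y X ≅ᵇ TensorUnit.bisemimodule {R = S})
  where
  private
    module K = Semiring K
    module S = Semiring S
    module X = Bisemimodule X
    module Y = Bisemimodule Y
    module XY = Tensor X Y
    module YX = Tensor Y X
    φ = proj₁ X⊗Y≅K
    ψ = proj₁ Y⊗X≅S
    module φ = IsBisemimoduleIsomorphism (proj₂ X⊗Y≅K)
    module ψ = IsBisemimoduleIsomorphism (proj₂ Y⊗X≅S)
    module ΣX = BisemimoduleSum X
    module ΣK = SemiringSum K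
    module ΣS = SemiringSum S
    module LiftX = TensorLift Y X X.+ᴹ-commutativeMonoid
    open LiftX using (lift)

  -- The two pairings and their contraction

  ⟨_,_⟩ : X.Carrierᴹ → Y.Carrierᴹ → K.Carrier
  ⟨ x , y ⟩ = φ (x XY.⊗ y)

  [_,_] : Y.Carrierᴹ → X.Carrierᴹ → S.Carrier
  [ y , x ] = ψ (y YX.⊗ x)

  ⟨,⟩-linear : ∀ y → IsLeftFunctional X (λ x → ⟨ x , y ⟩)
  ⟨,⟩-linear y = record
    { +ᴹ-isMonoidHomomorphism = isMonoidHomomorphism X.+ᴹ-monoid K.+-monoid
        (λ p → φ.⟦⟧-cong (XY.⊗-cong p Y.≈ᴹ-refl))
        (λ x x′ → K.trans (φ.⟦⟧-cong (XY.⊗-addˡ x x′ y)) (φ.+ᴹ-homo _ _))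
        (K.trans (φ.⟦⟧-cong (XY.⊗-zeroˡ y)) φ.0ᴹ-homo)
    ; *ₗ-homo = λ a x → φ.*ₗ-homo a (x XY.⊗ y)
    }

  [,]-linear : ∀ y → IsRightFunctional X [ y ,_]
  [,]-linear y = record
    { +ᴹ-isMonoidHomomorphism = isMonoidHomomorphism X.+ᴹ-monoid S.+-monoid
        (λ p → ψ.⟦⟧-cong (YX.⊗-cong Y.≈ᴹ-refl p))
        (λ x x′ → S.trans (ψ.⟦⟧-cong (YX.⊗-addʳ y x x′)) (ψ.+ᴹ-homo _ _))
        (S.trans (ψ.⟦⟧-cong (YX.⊗-zeroʳ y)) ψ.0ᴹ-homo)
    ; *ᵣ-homo = λ s x → ψ.*ᵣ-homo s (y YX.⊗ x)
    }

  -- Its lift sends `w` in the tensor product of `Y` and `X` to the value of `φ` on the first two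
  -- factors of `z ⊗ w`. Fixing `z` avoids a triple tensor product.
  contract : X.Carrierᴹ → Y.Carrierᴹ → X.Carrierᴹ → X.Carrierᴹ
  contract z y x = ⟨ z , y ⟩ X.*ₗ x

  contract-balanced : ∀ z → LiftX.IsBalanced (contract z)
  contract-balanced z = record
    { cong  = λ p q → X.*ₗ-cong (φ.⟦⟧-cong (XY.⊗-cong X.≈ᴹ-refl p)) q
    ; +ˡ    = λ y y′ x → X.≈ᴹ-trans
        (X.*ₗ-cong (K.trans (φ.⟦⟧-cong (XY.⊗-addʳ z y y′)) (φ.+ᴹ-homo _ _)) X.≈ᴹ-refl)
        (X.*ₗ-distribʳ x _ _)
    ; +ʳ    = λ y x x′ → X.*ₗ-distribˡ _ x x′
    ; zeroˡ = λ x → X.≈ᴹ-trans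
        (X.*ₗ-cong (K.trans (φ.⟦⟧-cong (XY.⊗-zeroʳ z)) φ.0ᴹ-homo) X.≈ᴹ-refl)
        (X.*ₗ-zeroˡ x)
    ; zeroʳ = λ y → X.*ₗ-zeroʳ _
    ; bal   = λ y a x → X.≈ᴹ-trans
        (X.*ₗ-cong (φ.*ᵣ-homo a (z XY.⊗ y)) X.≈ᴹ-refl)
        (X.*ₗ-assoc _ a x)
    }

  lift-contract-·ᵣ : ∀ z w s → lift (contract z) (w YX.·ᵣ s) X.≈ᴹ lift (contract z) w X.*ᵣ s
  lift-contract-·ᵣ z []            s = X.≈ᴹ-sym (X.*ᵣ-zeroˡ s)
  lift-contract-·ᵣ z ((y , x) ∷ w) s = X.≈ᴹ-trans
    (X.+ᴹ-cong (X.≈ᴹ-sym (X.*ₗ-*ᵣ-assoc _ x s)) (lift-contract-·ᵣ z w s))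
    (X.≈ᴹ-sym (X.*ᵣ-distribʳ s _ _))

  -- Balancedness over `S` in the tensor product of `X` and `Y` moves `s` from `y` across to `z`.
  lift-contract-·ₗ : ∀ z w s → lift (contract z) (s YX.·ₗ w) X.≈ᴹ lift (contract (z X.*ᵣ s)) w
  lift-contract-·ₗ z []            s = X.≈ᴹ-refl
  lift-contract-·ₗ z ((y , x) ∷ w) s = X.+ᴹ-cong
    (X.*ₗ-cong (φ.⟦⟧-cong (XY.∼-sym (XY.⊗-bal z s y))) X.≈ᴹ-refl) (lift-contract-·ₗ z w s)

  -- The leading (0 , 0) ensures that the list is not empty.
  unitˢ : YX.FormalSum
  unitˢ = (Y.0ᴹ , X.0ᴹ) ∷ proj₁ (ψ.surjective S.1#)

  ψ-unitˢ : ψ unitˢ S.≈ S.1#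
  ψ-unitˢ = proj₂ (ψ.surjective S.1#) (YX.++-cong (YX.⊗-zeroˡ X.0ᴹ) YX.∼-refl)

  unitᴷ : XY.FormalSum
  unitᴷ = proj₁ (φ.surjective K.1#)

  xs : Vector X.Carrierᴹ (length unitˢ)
  xs j = proj₂ (lookup unitˢ j)

  ys : Vector Y.Carrierᴹ (length unitˢ)
  ys j = proj₁ (lookup unitˢ j)

  us : Vector X.Carrierᴹ (length unitᴷ)
  us i = proj₁ (lookup unitᴷ i)

  vs : Vector Y.Carrierᴹ (length unitᴷ)
  vs i = proj₂ (lookup unitᴷ i)

  [ys,xs]≈1 : ΣS.sum (λ j → [ ys j , xs j ]) S.≈ S.1#
  [ys,xs]≈1 = S.trans
    (S.sym (TensorLift.homo-as-lift Y X S.+-commutativeMonoid ψ.+ᴹ-isMonoidHomomorphism unitˢ))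
    ψ-unitˢ

  ⟨us,vs⟩≈1 : ΣK.sum (λ i → ⟨ us i , vs i ⟩) K.≈ K.1#
  ⟨us,vs⟩≈1 = K.trans
    (K.sym (TensorLift.homo-as-lift X Y K.+-commutativeMonoid φ.+ᴹ-isMonoidHomomorphism unitᴷ))
    (proj₂ (φ.surjective K.1#) XY.∼-refl)

  -- The comparison map of the two contractions and its right inverse

  α : X.Carrierᴹ → X.Carrierᴹ
  α z = lift (contract z) unitˢ

  α-cong : ∀ {z z′} → z X.≈ᴹ z′ → α z X.≈ᴹ α z′
  α-cong p = ΣX.sum-cong-≋ λ j →
    X.*ₗ-cong (IsLeftSemimoduleHomomorphism.⟦⟧-cong (⟨,⟩-linear (ys j)) p) (X.≈ᴹ-refl {xs j})

  α-homo : IsMonoidHomomorphism X.+ᴹ-rawMonoid X.+ᴹ-rawMonoid α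
  α-homo = isMonoidHomomorphism X.+ᴹ-monoid X.+ᴹ-monoid α-cong
    (λ z z′ → X.≈ᴹ-trans
      (ΣX.sum-cong-≋ λ j → X.≈ᴹ-trans
        (X.*ₗ-cong (IsLeftSemimoduleHomomorphism.+ᴹ-homo (⟨,⟩-linear (ys j)) z z′) X.≈ᴹ-refl)
        (X.*ₗ-distribʳ (xs j) _ _))
      (ΣX.∑-distrib-+ (λ j → contract z (ys j) (xs j)) (λ j → contract z′ (ys j) (xs j))))
    (X.≈ᴹ-trans
      (ΣX.sum-cong-≋ λ j → X.≈ᴹ-trans
        (X.*ₗ-cong (IsLeftSemimoduleHomomorphism.0ᴹ-homo (⟨,⟩-linear (ys j))) X.≈ᴹ-refl)
        (X.*ₗ-zeroˡ (xs j)))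
      (ΣX.sum-replicate-zero (length unitˢ)))

  -- For s = [ y , x ], the injective map ψ sends s · unitˢ, unitˢ · s and y ⊗ x to s.

  α-*ᵣ-[,] : ∀ z y x → α z X.*ᵣ [ y , x ] X.≈ᴹ ⟨ z , y ⟩ X.*ₗ x
  α-*ᵣ-[,] z y x = begin
    α z X.*ᵣ [ y , x ]                        ≈⟨ lift-contract-·ᵣ z unitˢ [ y , x ] ⟨
    lift (contract z) (unitˢ YX.·ᵣ [ y , x ]) ≈⟨ LiftX.lift-cong (contract-balanced z) (ψ.injective ψ-eq) ⟩
    lift (contract z) (y YX.⊗ x)              ≈⟨ LiftX.lift-⊗ (contract z) y x ⟩
    ⟨ z , y ⟩ X.*ₗ x                          ∎
    where
    open SetoidReasoning X.≈ᴹ-setoid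
    ψ-eq : ψ (unitˢ YX.·ᵣ [ y , x ]) S.≈ [ y , x ]
    ψ-eq = S.trans (ψ.*ᵣ-homo _ unitˢ) (S.trans (S.*-congʳ ψ-unitˢ) (S.*-identityˡ _))

  α-[,] : ∀ z y x → α (z X.*ᵣ [ y , x ]) X.≈ᴹ ⟨ z , y ⟩ X.*ₗ x
  α-[,] z y x = begin
    α (z X.*ᵣ [ y , x ])                      ≈⟨ lift-contract-·ₗ z unitˢ [ y , x ] ⟨
    lift (contract z) ([ y , x ] YX.·ₗ unitˢ) ≈⟨ LiftX.lift-cong (contract-balanced z) (ψ.injective ψ-eq) ⟩
    lift (contract z) (y YX.⊗ x)              ≈⟨ LiftX.lift-⊗ (contract z) y x ⟩
    ⟨ z , y ⟩ X.*ₗ x                          ∎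
    where
    open SetoidReasoning X.≈ᴹ-setoid
    ψ-eq : ψ ([ y , x ] YX.·ₗ unitˢ) S.≈ [ y , x ]
    ψ-eq = S.trans (ψ.*ₗ-homo _ unitˢ) (S.trans (S.*-congˡ ψ-unitˢ) (S.*-identityʳ _))

  -- The mirror image of `α`: here `unitᴷ ⊗ x` is contracted by `ψ` on the last two factors. By
  -- `α-[,]`, applying `α` turns each term into `⟨ us i , vs i ⟩ X.*ₗ x`, and the coefficients sum
  -- to one.
  β : X.Carrierᴹ → X.Carrierᴹ
  β x = ΣX.sum (λ i → us i X.*ᵣ [ vs i , x ])

  α-β : ∀ x → α (β x) X.≈ᴹ x
  α-β x = begin
    α (β x)
      ≈⟨ sum-homo X.+ᴹ-monoid X.+ᴹ-monoid α-homo (λ i → us i X.*ᵣ [ vs i , x ]) ⟩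
    ΣX.sum (λ i → α (us i X.*ᵣ [ vs i , x ]))      ≈⟨ ΣX.sum-cong-≋ (λ i → α-[,] (us i) (vs i) x) ⟩
    ΣX.sum (λ i → ⟨ us i , vs i ⟩ X.*ₗ x)          ≈⟨ ΣX.*ₗ-distribʳ-sum (λ i → ⟨ us i , vs i ⟩) x ⟨
    ΣK.sum (λ i → ⟨ us i , vs i ⟩) X.*ₗ x          ≈⟨ X.*ₗ-cong ⟨us,vs⟩≈1 X.≈ᴹ-refl ⟩
    K.1# X.*ₗ x                                    ≈⟨ X.*ₗ-identityˡ x ⟩
    x                                              ∎
    where open SetoidReasoning X.≈ᴹ-setoid

  dualBasis : DualBasis X
  dualBasis = record
    { gen     = xs
    ; ξ       = λ j z → ⟨ β z , ys j ⟩
    ; η       = λ j → [ ys j ,_]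
    ; η-homo  = λ j → [,]-linear (ys j)
    -- `α-*ᵣ-[,]` at `β z` leaves `α (β z)` on the right, which `α-β` reduces to `z`.
    ; ξ-η     = λ j z z′ → X.≈ᴹ-trans (X.≈ᴹ-sym (α-*ᵣ-[,] (β z) (ys j) z′))
                                      (X.*ᵣ-cong (α-β z) S.refl)
    ; η-gen   = [ys,xs]≈1
    ; point   = us
    -- The pairing is taken at `z` itself, not at `β z`: `ζ` has to be left linear and normalised,
    -- and is not matched with any `η`.
    ; ζ       = λ i z → ⟨ z , vs i ⟩
    ; ζ-homo  = λ i → ⟨,⟩-linear (vs i)
    ; ζ-point = ⟨us,vs⟩≈1
    }

mainTheorem4 : {c ℓ c′ ℓ′ x ℓx y ℓy : Level}
    (K : KleeneAlgebra c ℓ) (S : KleeneAlgebra c′ ℓ′) →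
    MoritaEquivalent K S x ℓx y ℓy →
    Σ ℕ λ n → 0 < n ×
    (let M = matrixSemiring (KleeneAlgebra.semiring K) n in
    Σ (Semiring.Carrier M) λ e → Σ (IsIdempotentElement M e) λ ee≈e →
    IsFull M e × (KleeneAlgebra.semiring S ≅ˢ corner M e ee≈e))
-- The rank is `length unitˢ`, a successor by computation because of the leading zero tensor; hence
-- `s≤s z≤n`.
mainTheorem4 K S K~S = isFullCorner dualBasis (s≤s z≤n)
  where
  open MoritaEquivalent K~S
  open InverseBimodules (KleeneBimodule.bisemimodule X) (KleeneBimodule.bisemimodule Y)
                        X⊗Y≅K Y⊗X≅S
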